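{- Let $\kappa$ be a regular uncountable cardinal with $\kappa^{<\kappa}=\kappa$. If $G \leq S(\kappa)$ is a $\kappa$-maximal cofinitary group, then $G$ has less than $\kappa$ many orbits (under its natural action $(g,\alpha)\mapsto g(\alpha)$ on $\kappa$).
   Context: $S(\kappa)$ is the group of all permutations of $\kappa$. A permutation $f\in S(\kappa)$ is $\kappa$-cofinitary if it has fewer than $\kappa$ many fixed points. A subgroup $G\leq S(\kappa)$ is $\kappa$-cofinitary if all of its non-identity elements are $\kappa$-cofinitary. A $\kappa$-maximal cofinitary group is a $\kappa$-cofinitary group $G\leq S(\kappa)$ such that no proper supergroup of $G$ in $S(\kappa)$ is $\kappa$-cofinitary. -}

module Defs where

open import Level using (Level; _⊔_) renaming (suc to lsuc)
open import Data.Nat.Base using (ℕ)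
open import Data.Product.Base using (Σ; ∃; _×_; _,_; proj₁; proj₂)
open import Function.Bundles using (Func; Injection; Inverse; _↔_)
open import Function.Construct.Composition using (_↔-∘_)
open import Function.Construct.Identity using (↔-id)
open import Function.Construct.Symmetry using (↔-sym)
open import Induction.WellFounded using (WellFounded)
open import Relation.Binary.Bundles using (Setoid)
open import Relation.Binary.Core using (Rel)
open import Relation.Binary.PropositionalEquality
  using (_≡_; refl; sym; trans; cong; subst; setoid)
open import Relation.Binary.Structures using (IsStrictTotalOrder)
open import Relation.Nullary using (¬_)
open import Relation.Unary using (Pred; _∈_; _⊂_)
import Relation.Binary.Construct.On as On
import Relation.Binary.Construct.StrictToNonStrict as StrictToNonStrict

-- Cardinalities are compared on setoids, so that subsets (membership proofs
-- are ignored), sets of functions (compared pointwise) and sets of orbits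
-- (quotients) have the intended size.

infix 4 _≼_ _≺_

_≼_ : ∀ {a ℓ₁ b ℓ₂} → Setoid a ℓ₁ → Setoid b ℓ₂ → Set (a ⊔ ℓ₁ ⊔ b ⊔ ℓ₂)
A ≼ B = Injection A B

_≺_ : ∀ {a ℓ₁ b ℓ₂} → Setoid a ℓ₁ → Setoid b ℓ₂ → Set (a ⊔ ℓ₁ ⊔ b ⊔ ℓ₂)
A ≺ B = A ≼ B × ¬ (B ≼ A)

Subset : ∀ {a p} {A : Set a} → Pred A p → Setoid (a ⊔ p) a
Subset {A = A} P = On.setoid {B = Σ A P} (setoid A) proj₁

-- Cardinals are initial ordinals: well-ordered sets that are strictly larger
-- than each of their proper initial segments.

record Cardinal (a : Level) : Set (lsuc a) where
  infix 4 _<_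
  field
    Carrier            : Set a
    _<_                : Rel Carrier a
    isStrictTotalOrder : IsStrictTotalOrder _≡_ _<_
    wellFounded        : WellFounded _<_

  Seg : Carrier → Setoid a a
  Seg α = Subset (λ β → β < α)

  field
    initial : ∀ α → Seg α ≺ setoid Carrier

  open StrictToNonStrict _≡_ _<_ public using (_≤_)

module _ {a : Level} (κ : Cardinal a) where
  open Cardinal κ

  Uncountable : Set a
  Uncountable = setoid ℕ ≺ setoid Carrier

  Cofinal : ∀ {α} → Func (Seg α) (setoid Carrier) → Set a
  Cofinal f = ∀ β → ∃ λ γ → β ≤ Func.to f γ

  -- cf(κ) = κ, for infinite κ.
  Regular : Set a
  Regular = ∀ α (f : Func (Seg α) (setoid Carrier)) → ¬ Cofinal f

  -- The set ⋃_{α<κ} {f | f : α → κ}, whose cardinality is κ^{<κ}.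
  -- Sequences are equal when they have the same length and the same values.
  Seq< : Setoid a a
  Seq< = record
    { Carrier       = Σ Carrier λ α → Func (Seg α) (setoid Carrier)
    ; _≈_           = λ (α , f) (β , g) → α ≡ β ×
                        (∀ γ (p : γ < α) (q : γ < β) →
                           Func.to f (γ , p) ≡ Func.to g (γ , q))
    ; isEquivalence = record
      { refl  = λ { {α , f} → refl , λ γ p q → Func.cong f refl }
      ; sym   = λ (e , h) → sym e , λ γ p q → sym (h γ q p)
      ; trans = λ (e , h) (e′ , h′) → trans e e′ , λ γ p q →
                  trans (h γ p (subst (γ <_) e p)) (h′ γ (subst (γ <_) e p) q)
      }
    }

  κ^<κ≡κ : Set a
  κ^<κ≡κ = Inverse Seq< (setoid Carrier)

  Perm : Set a
  Perm = Carrier ↔ Carrier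

  infix 4 _≗ₚ_
  _≗ₚ_ : Rel Perm a
  f ≗ₚ g = ∀ α → Inverse.to f α ≡ Inverse.to g α

  -- Closure under _≗ₚ_ makes the predicate a subset of S(κ), as
  -- permutations are identified when they agree pointwise.
  record Subgroup : Set (lsuc a) where
    field
      Member    : Pred Perm a
      ≗ₚ-closed : ∀ {f g} → f ≗ₚ g → f ∈ Member → g ∈ Member
      id-closed : ↔-id Carrier ∈ Member
      ∘-closed  : ∀ {f g} → f ∈ Member → g ∈ Member → (f ↔-∘ g) ∈ Member
      ⁻¹-closed : ∀ {f} → f ∈ Member → ↔-sym f ∈ Member

  Fix : Perm → Pred Carrier a
  Fix f α = Inverse.to f α ≡ α

  IsCofinitary : Perm → Set a
  IsCofinitary f = Subset (Fix f) ≺ setoid Carrier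

  IsCofinitaryGroup : Subgroup → Set a
  IsCofinitaryGroup G =
    ∀ g → g ∈ Subgroup.Member G → ¬ (g ≗ₚ ↔-id Carrier) → IsCofinitary g

  IsMaximalCofinitaryGroup : Subgroup → Set (lsuc a)
  IsMaximalCofinitaryGroup G = IsCofinitaryGroup G ×
    (∀ (H : Subgroup) → Subgroup.Member G ⊂ Subgroup.Member H →
       ¬ IsCofinitaryGroup H)

  -- The quotient of κ by the orbit equivalence relation of G.
  Orbits : Subgroup → Setoid a a
  Orbits G = record
    { Carrier       = Carrier
    ; _≈_           = λ α β → ∃ λ g → g ∈ Member × Inverse.to g α ≡ β
    ; isEquivalence = record
      { refl  = ↔-id Carrier , id-closed , refl
      ; sym   = λ (g , g∈G , e) →
                  ↔-sym g , ⁻¹-closed g∈G , Inverse.inverseʳ g (sym e)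
      ; trans = λ (g , g∈G , e) (h , h∈G , e′) →
                  h ↔-∘ g , ∘-closed h∈G g∈G , trans (cong (Inverse.to h) e) e′
      }
    }
    where open Subgroup G

{-# OPTIONS --safe #-}
-- Suppose G had κ many orbits. Then the set R of least orbit representatives is
-- unbounded in κ, so there is a strictly increasing φ : κ → R with α < φ α.
-- Match each α that is not yet matched to something smaller with φ α; this gives
-- a fixed-point-free involution h such that the graph on the orbits of G with
-- edges [α] — [h α] is a forest: the only point of an orbit that h can send to
-- an orbit with a smaller representative is the representative itself.
-- A fixed point of a word h gₙ ⋯ h g₁ traces a closed walk in this forest.
-- Where the walk is highest it enters and leaves the orbit through its
-- representative, which is therefore fixed by the letter gᵢ applied there. If no
-- gᵢ is the identity, this leaves fewer than κ fixed points. If some gᵢ is the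
-- identity, then up to conjugation h² = 1 shortens the word. Hence ⟨G , h⟩ is
-- cofinitary, and it properly contains G because h preserves no orbit.
module Submission where

open import Defs
open import Axiom.DoubleNegationElimination using (em⇒dne)
open import Axiom.ExcludedMiddle using (ExcludedMiddle)
open import Data.Empty.Polymorphic using (⊥)
open import Data.List.Base using (List; []; _∷_; [_]; _++_; _∷ʳ_; length; initLast; _∷ʳ′_)
open import Data.List.Properties using (length-++; length-++-comm)
open import Data.List.Membership.Propositional using (find)
open import Data.List.Membership.Propositional.Properties using (∈-∃++)
open import Data.List.Relation.Unary.All as All using (All; []; _∷_)
open import Data.List.Relation.Unary.Any using (Any)
import Data.Nat.Base as ℕ
open import Data.Nat.Induction using (<-wellFounded)
import Data.Nat.Properties as ℕ
open import Data.Product.Base using (∃; ∃₂; _×_; _,_; proj₁; proj₂)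
open import Data.Sum.Base using (_⊎_; inj₁; inj₂; [_,_]′; swap)
open import Function.Base using (_∘_; id)
open import Function.Bundles using (Inverse; Injection; mk↔ₛ′)
open import Function.Construct.Composition using (_↔-∘_)
open import Function.Construct.Identity using (↔-id)
open import Function.Construct.Symmetry using (↔-sym)
open import Function.Properties.Inverse using (↔⇒↣)
open import Induction.WellFounded using (Acc; acc; module All; module FixPoint)
open import Level using (Level)
open import Relation.Binary.Bundles using (Setoid)
open import Relation.Binary.Definitions using (tri<; tri≈; tri>)
open import Relation.Binary.PropositionalEquality
  using (_≡_; _≢_; refl; sym; trans; cong; subst; setoid)
open import Relation.Binary.Structures using (IsStrictTotalOrder)
open import Relation.Nullary using (¬_; yes; no; contradiction)
open import Relation.Nullary.Decidable using (toSum)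
open import Relation.Unary using (Pred; _∈_; _⊆_; _∪_; _⊂_)

-- Consequences of excluded middle.

module Classical {a} (em : ExcludedMiddle a) where

  dne : ∀ {P : Set a} → ¬ ¬ P → P
  dne = em⇒dne em

  ¬∀⇒∃¬ : ∀ {A : Set a} {P : Pred A a} → ¬ (∀ x → P x) → ∃ λ x → ¬ P x
  ¬∀⇒∃¬ ¬∀ = dne λ ¬∃ → ¬∀ λ x → dne λ ¬p → ¬∃ (x , ¬p)

-- Least elements and bounded sets.

module WellOrder {a} (em : ExcludedMiddle a) (κ : Cardinal a) where
  open Classical em
  open Cardinal κ
  open IsStrictTotalOrder isStrictTotalOrder public
    using (compare; irrefl) renaming (trans to <-trans)

  ≤-<-trans : ∀ {x y z} → x ≤ y → y < z → x < z
  ≤-<-trans (inj₁ x<y)  y<z = <-trans x<y y<z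
  ≤-<-trans (inj₂ refl) y<z = y<z

  <-≤-trans : ∀ {x y z} → x < y → y ≤ z → x < z
  <-≤-trans x<y (inj₁ y<z)  = <-trans x<y y<z
  <-≤-trans x<y (inj₂ refl) = x<y

  ≤-trans : ∀ {x y z} → x ≤ y → y ≤ z → x ≤ z
  ≤-trans (inj₁ x<y)  y≤z = inj₁ (<-≤-trans x<y y≤z)
  ≤-trans (inj₂ refl) y≤z = y≤z

  <⇒≱ : ∀ {x y} → x < y → ¬ (y ≤ x)
  <⇒≱ x<y y≤x = irrefl refl (<-≤-trans x<y y≤x)

  ≮⇒≥ : ∀ {x y} → ¬ (x < y) → y ≤ x
  ≮⇒≥ {x} {y} x≮y with compare x y
  ... | tri< x<y _ _ = contradiction x<y x≮y
  ... | tri≈ _ x≡y _ = inj₂ (sym x≡y)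
  ... | tri> _ _ y<x = inj₁ y<x

  ≰⇒> : ∀ {x y} → ¬ (x ≤ y) → y < x
  ≰⇒> x≰y = dne λ y≮x → x≰y (≮⇒≥ y≮x)

  ≤-antisym : ∀ {x y} → x ≤ y → y ≤ x → x ≡ y
  ≤-antisym (inj₁ x<y) y≤x = contradiction y≤x (<⇒≱ x<y)
  ≤-antisym (inj₂ x≡y) _   = x≡y

  upperBound₂ : ∀ x y → ∃ λ z → x ≤ z × y ≤ z
  upperBound₂ x y with compare x y
  ... | tri< x<y _ _ = y , inj₁ x<y , inj₂ refl
  ... | tri≈ _ x≡y _ = y , inj₂ x≡y , inj₂ refl
  ... | tri> _ _ y<x = x , inj₂ refl , inj₁ y<x

  IsLeast : Pred Carrier a → Carrier → Set a
  IsLeast P m = P m × (∀ x → P x → m ≤ x)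

  least : ∀ P x → P x → ∃ (IsLeast P)
  least P = All.wfRec wellFounded a (λ x → P x → ∃ (IsLeast P)) λ x rec px →
    [ (λ (y , y<x , py) → rec y<x py)
    , (λ none → x , px , λ y py → ≮⇒≥ λ y<x → none (y , y<x , py))
    ]′ (toSum em)

  isLeast-unique : ∀ {P Q x y} → P ⊆ Q → Q ⊆ P → IsLeast P x → IsLeast Q y → x ≡ y
  isLeast-unique P⊆Q Q⊆P (px , x≤) (qy , y≤) = ≤-antisym (x≤ _ (Q⊆P qy)) (y≤ _ (P⊆Q px))

  -- The least element of P, or the junk value d if P is empty.
  μ : Pred Carrier a → Carrier → Carrier
  μ P d with em {∃ P}
  ... | yes (x , px) = proj₁ (least P x px)
  ... | no _         = d

  μ-satisfies : ∀ P d → ∃ P → P (μ P d)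
  μ-satisfies P d ∃P with em {∃ P}
  ... | yes (x , px) = proj₁ (proj₂ (least P x px))
  ... | no ∄P        = contradiction ∃P ∄P

  -- Lets a recursion through `μ` unfold without function extensionality.
  μ-cong : ∀ {P Q} d → P ⊆ Q → Q ⊆ P → μ P d ≡ μ Q d
  μ-cong {P} {Q} d P⊆Q Q⊆P with em {∃ P} | em {∃ Q}
  ... | yes (x , px) | yes (y , qy) =
        isLeast-unique {P} {Q} P⊆Q Q⊆P (proj₂ (least P x px)) (proj₂ (least Q y qy))
  ... | yes (x , px) | no ∄Q        = contradiction (x , P⊆Q px) ∄Q
  ... | no ∄P        | yes (y , qy) = contradiction (y , Q⊆P qy) ∄P
  ... | no _         | no _         = refl

  Bounded : Pred Carrier a → Set a
  Bounded P = ∃ λ β → ∀ x → P x → x < β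

  bounded-∪ : ∀ {P Q} → Bounded P → Bounded Q → Bounded (P ∪ Q)
  bounded-∪ (β , P<β) (γ , Q<γ) =
    let δ , β≤δ , γ≤δ = upperBound₂ β γ in
    δ , λ x → [ (λ p → <-≤-trans (P<β x p) β≤δ) , (λ q → <-≤-trans (Q<γ x q) γ≤δ) ]′

  bounded-⊆ : ∀ {P Q} → P ⊆ Q → Bounded Q → Bounded P
  bounded-⊆ P⊆Q (β , Q<β) = β , λ x p → Q<β x (P⊆Q p)

  -- A bound `β` would turn such an injection into one of the whole cardinal into the segment below
  -- `β`, against initiality.
  bounded⇒⋡ : ∀ {P} → Bounded P → ¬ (setoid Carrier ≼ Subset P)
  bounded⇒⋡ (β , P<β) i = proj₂ (initial β) record
    { to        = λ x → proj₁ (to x) , P<β _ (proj₂ (to x))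
    ; cong      = I.cong
    ; injective = injective
    }
    where
    module I = Injection i
    open I using (to; injective)

  bounded⇒≺ : ∀ {P} → Bounded P → Subset P ≺ setoid Carrier
  bounded⇒≺ P-bounded = record { to = proj₁ ; cong = id ; injective = id } , bounded⇒⋡ P-bounded

-- Regularity, enumerations and the matching.

module RegularCardinal {a} (em : ExcludedMiddle a) (κ : Cardinal a)
  (uncountable : Uncountable κ) (regular : Regular κ) where
  open Classical em
  open Cardinal κ
  open WellOrder em κ public

  -- By regularity `f` is not cofinal on the segment below `α`; a point witnessing this is a strict
  -- bound.
  image-bounded : ∀ α (f : Carrier → Carrier) → ∃ λ β → ∀ γ → γ < α → f γ < β
  image-bounded α f =
    let β , ¬reached = ¬∀⇒∃¬ (regular α record { to = f ∘ proj₁ ; cong = cong f })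
    in β , λ γ γ<α → ≰⇒> λ β≤fγ → ¬reached ((γ , γ<α) , β≤fγ)

  ∃-< : ∃₂ λ x y → x < y
  ∃-< with compare (to 0) (to 1)
    where open Injection (proj₁ uncountable)
  ... | tri< x<y _ _ = _ , _ , x<y
  ... | tri≈ _ x≡y _ with () ← Injection.injective (proj₁ uncountable) x≡y
  ... | tri> _ _ y<x = _ , _ , y<x

  ∃-above : ∀ α → ∃ λ β → α < β
  ∃-above α =
    let x , y , x<y  = ∃-<
        β , const<β = image-bounded y (λ _ → α)
    in β , const<β x x<y

  bounded-∅ : Bounded (λ _ → ⊥)
  bounded-∅ = proj₁ ∃-< , λ _ ()

  -- A preimage under `k` is an image under its inverse, here of a set inside a proper segment.
  bounded-preimage : ∀ {P} (k : Perm κ) → Bounded P → Bounded (P ∘ Inverse.to k)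
  bounded-preimage k (β , P<β) =
    let γ , k⁻¹<γ = image-bounded β (Inverse.from k)
    in γ , λ x p → subst (_< γ) (Inverse.strictlyInverseʳ k x) (k⁻¹<γ _ (P<β _ p))

  module Enumeration (A : Pred Carrier a) (unbounded : ¬ Bounded A) where

    IsNext : ∀ α → (∀ {β} → β < α → Carrier) → Pred Carrier a
    IsNext α e x = A x × α < x × (∀ {β} (β<α : β < α) → e β<α < x)

    private
      -- The default `α` lets the recursion be set up before a next element is known to exist;
      -- `∃-isNext` then shows that it is never returned.
      step : ∀ α → (∀ {β} → β < α → Carrier) → Carrier
      step α e = μ (IsNext α e) α

      step-ext : ∀ α {e e′ : ∀ {β} → β < α → Carrier} →
        (∀ {β} (β<α : β < α) → e β<α ≡ e′ β<α) → step α e ≡ step α e′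
      step-ext α e≡e′ = μ-cong α
        (λ (x∈A , α<x , e<x) → x∈A , α<x , λ β<α → subst (_< _) (e≡e′ β<α) (e<x β<α))
        (λ (x∈A , α<x , e<x) → x∈A , α<x , λ β<α → subst (_< _) (sym (e≡e′ β<α)) (e<x β<α))

    abstract
      φ : Carrier → Carrier
      φ = All.wfRec wellFounded a (λ _ → Carrier) step

      ∃-isNext : ∀ α → ∃ (IsNext α (λ {β} _ → φ β))
      ∃-isNext α =
        let β , φ<β       = image-bounded α φ
            γ , α<γ       = ∃-above α
            δ , β≤δ , γ≤δ = upperBound₂ β γ
            x , ¬A⇒<      = ¬∀⇒∃¬ λ A<δ → unbounded (δ , A<δ)
            x∈A           = dne λ x∉A → ¬A⇒< λ x∈A → contradiction x∈A x∉A
            δ≤x           = ≮⇒≥ λ x<δ → ¬A⇒< λ _ → x<δ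
        in x , x∈A , <-≤-trans α<γ (≤-trans γ≤δ δ≤x)
             , λ β<α → <-≤-trans (φ<β _ β<α) (≤-trans β≤δ δ≤x)

      φ-isNext : ∀ α → IsNext α (λ {β} _ → φ β) (φ α)
      φ-isNext α = subst (IsNext α _)
        (sym (FixPoint.unfold-wfRec wellFounded (λ _ → Carrier) step step-ext))
        (μ-satisfies _ α (∃-isNext α))

    φ-∈ : ∀ α → A (φ α)
    φ-∈ α = proj₁ (φ-isNext α)

    φ-inflationary : ∀ α → α < φ α
    φ-inflationary α = proj₁ (proj₂ (φ-isNext α))

    φ-monotone : ∀ {α β} → α < β → φ α < φ β
    φ-monotone = proj₂ (proj₂ (φ-isNext _))

    φ-injective : ∀ {α β} → φ α ≡ φ β → α ≡ β
    φ-injective {α} {β} eq with compare α β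
    ... | tri< α<β _ _ = contradiction (φ-monotone α<β) (irrefl eq)
    ... | tri≈ _ α≡β _ = α≡β
    ... | tri> _ _ β<α = contradiction (φ-monotone β<α) (irrefl (sym eq))

  -- Enumerating an unbounded set injects the cardinal into it. With `bounded⇒≺`, being smaller than
  -- the cardinal amounts to being bounded.
  ⋡⇒bounded : ∀ {P} → ¬ (setoid Carrier ≼ Subset P) → Bounded P
  ⋡⇒bounded {P} ⋡ = dne λ unbounded →
    let open Enumeration P unbounded in
    ⋡ record { to = λ α → φ α , φ-∈ α ; cong = cong φ ; injective = φ-injective }

  -- The Up points are matched to a smaller one, the Down points to a larger one.
  module Matching (A : Pred Carrier a) (unbounded : ¬ Bounded A) where
    open Enumeration A unbounded public

    -- Going back along `φ` strictly decreases, so it stops outside the range of `φ`. The number of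
    -- steps is odd for `Up` and even for `Down`.
    mutual
      data Up (α : Carrier) : Set a where
        up : ∀ {β} → Down β → φ β ≡ α → Up α

      data Down (α : Carrier) : Set a where
        unreached : (∀ β → φ β ≢ α) → Down α
        skipped   : ∀ {β} → Up β → φ β ≡ α → Down α

    up∧down : ∀ {α} → Up α → ¬ Down α
    up∧down (up d eq) (unreached φ≢) = φ≢ _ eq
    up∧down (up d eq) (skipped u eq′) with refl ← φ-injective (trans eq (sym eq′)) = up∧down u d

    abstract
      side : ∀ α → Up α ⊎ Down α
      side = All.wfRec wellFounded a (λ α → Up α ⊎ Down α) λ α rec →
        [ (λ (β , eq) → [ (λ u → inj₂ (skipped u eq)) , (λ d → inj₁ (up d eq)) ]′
                          (rec (subst (β <_) eq (φ-inflationary β))))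
        , (λ none → inj₂ (unreached λ β eq → none (β , eq)))
        ]′ (toSum em)

      mate : Carrier → Carrier
      mate α with side α
      ... | inj₁ (up {β} _ _) = β
      ... | inj₂ _            = φ α

      mate-up : ∀ {α} → Up α → φ (mate α) ≡ α
      mate-up {α} u with side α
      ... | inj₁ (up _ eq) = eq
      ... | inj₂ d         = contradiction d (up∧down u)

      mate-down : ∀ {α} → Down α → mate α ≡ φ α
      mate-down {α} d with side α
      ... | inj₁ u = contradiction d (up∧down u)
      ... | inj₂ _ = refl

      mate-of-down-up : ∀ {α} → Down α → Up (mate α)
      mate-of-down-up d = up d (sym (mate-down d))

      mate-involutive : ∀ α → mate (mate α) ≡ α
      mate-involutive α with side α
      ... | inj₁ (up d eq) = trans (mate-down d) eq
      ... | inj₂ d         = φ-injective (mate-up (up d refl))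

    matching : Perm κ
    matching = mk↔ₛ′ mate mate mate-involutive mate-involutive

    -- The larger point of a matched pair is a value of `φ`; the smaller one may lie anywhere.
    up⇒∈ : ∀ {α} → Up α → A α
    up⇒∈ (up {β} _ eq) = subst A eq (φ-∈ β)

    mate-up-< : ∀ {α} → Up α → mate α < α
    mate-up-< {α} u = subst (mate α <_) (mate-up u) (φ-inflationary (mate α))

-- Least orbit representatives.

module OrbitRepresentatives {a} (em : ExcludedMiddle a) (κ : Cardinal a) (G : Subgroup κ) where
  open Cardinal κ
  open WellOrder em κ
  open Subgroup G

  infix 4 _~_
  _~_ : Carrier → Carrier → Set a
  α ~ β = ∃ λ g → g ∈ Member × Inverse.to g α ≡ β

  open Setoid (Orbits κ G) using () renaming (refl to ~-refl; sym to ~-sym; trans to ~-trans)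

  abstract
    ∃-rep : ∀ α → ∃ (IsLeast (α ~_))
    ∃-rep α = least (α ~_) α ~-refl

  rep : Carrier → Carrier
  rep α = proj₁ (∃-rep α)

  rep-~ : ∀ α → α ~ rep α
  rep-~ α = proj₁ (proj₂ (∃-rep α))

  rep-≤ : ∀ α → rep α ≤ α
  rep-≤ α = proj₂ (proj₂ (∃-rep α)) α ~-refl

  rep-cong : ∀ {α β} → α ~ β → rep α ≡ rep β
  rep-cong {α} {β} α~β = isLeast-unique {α ~_} {β ~_}
    (~-trans (~-sym α~β)) (~-trans α~β) (proj₂ (∃-rep α)) (proj₂ (∃-rep β))

  rep-injective : ∀ {α β} → rep α ≡ rep β → α ~ β
  rep-injective {α} {β} eq = ~-trans (subst (α ~_) eq (rep-~ α)) (~-sym (rep-~ β))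

  Orbits≼κ : Orbits κ G ≼ setoid Carrier
  Orbits≼κ = record { to = rep ; cong = rep-cong ; injective = rep-injective }

-- The matching on the orbits of `G`.

module Extension {a} (em : ExcludedMiddle a) (κ : Cardinal a)
  (uncountable : Uncountable κ) (regular : Regular κ)
  (G : Subgroup κ) (cofinitary : IsCofinitaryGroup κ G)
  (κ≼Orbits : setoid (Cardinal.Carrier κ) ≼ Orbits κ G) where
  open Classical em
  open Cardinal κ
  open RegularCardinal em κ uncountable regular
  open OrbitRepresentatives em κ G
  open Subgroup G

  infixr 9 _∙_
  _∙_ : Perm κ → Perm κ → Perm κ
  f ∙ g = f ↔-∘ g

  infixl 10 _$ₚ_
  _$ₚ_ : Perm κ → Carrier → Carrier
  _$ₚ_ = Inverse.to

  Trivial : Pred (Perm κ) a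
  Trivial f = _≗ₚ_ κ f (↔-id Carrier)

  IsRep : Pred Carrier a
  IsRep α = rep α ≡ α

  abstract
    -- Sending each of the many orbits to its representative would inject the cardinal into a
    -- bounded set.
    isRep-unbounded : ¬ Bounded IsRep
    isRep-unbounded bounded = bounded⇒⋡ bounded record
      { to        = λ α → rep (to α) , sym (rep-cong (rep-~ (to α)))
      ; cong      = cong (rep ∘ to)
      ; injective = injective ∘ rep-injective
      }
      where open Injection κ≼Orbits using (to; injective)

  open Matching IsRep isRep-unbounded renaming (mate to h; matching to hₚ)

  -- An `Up` point is the least of its orbit, so a smaller mate lies in an orbit with a smaller
  -- representative.
  h-up : ∀ {α} → Up α → rep (h α) < rep α
  h-up {α} u = subst (rep (h α) <_) (sym (up⇒∈ u)) (≤-<-trans (rep-≤ (h α)) (mate-up-< u))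

  h-down : ∀ {α} → Down α → rep α < rep (h α)
  h-down {α} d = subst (λ x → rep x < rep (h α)) (mate-involutive α) (h-up (mate-of-down-up d))

  h-leaves-orbit : ∀ α → rep (h α) ≢ rep α
  h-leaves-orbit α eq with side α
  ... | inj₁ u = irrefl eq (h-up u)
  ... | inj₂ d = irrefl (sym eq) (h-down d)

  -- Words and the walks they trace through the orbits.

  Letter : Set a
  Letter = ∃ Member

  act : Letter → Carrier → Carrier
  act c = Inverse.to (proj₁ c)

  rep-act : ∀ c x → rep (act c x) ≡ rep x
  rep-act (g , g∈G) x = sym (rep-cong (g , g∈G , refl))

  -- [ g₁ , … , gₙ ] stands for h gₙ ⋯ h g₁.
  run : List Letter → Perm κ
  run []       = ↔-id Carrier
  run (c ∷ cs) = run cs ∙ (hₚ ∙ proj₁ c)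

  run-++ : ∀ bs cs x → run (bs ++ cs) $ₚ x ≡ run cs $ₚ (run bs $ₚ x)
  run-++ []       cs x = refl
  run-++ (b ∷ bs) cs x = run-++ bs cs (h (act b x))

  -- A fixed letter is what lets a walk leave an orbit by the edge through which it entered.
  SomeFix : List Letter → Pred Carrier a
  SomeFix []       x = ⊥
  SomeFix (c ∷ cs) x = act c x ≡ x ⊎ SomeFix cs (h (act c x))

  -- Two `Up` points of one orbit are both its representative, hence equal.
  moved-up-down : ∀ c {x} → Up x → act c x ≢ x → Down (act c x)
  moved-up-down c {x} u cx≢x with side (act c x)
  ... | inj₁ u′ = contradiction (trans (sym (up⇒∈ u′)) (trans (rep-act c x) (up⇒∈ u))) cx≢x
  ... | inj₂ d  = d

  down-step : ∀ c x → Down (act c x) → rep x < rep (h (act c x))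
  down-step c x d = subst (_< rep (h (act c x))) (rep-act c x) (h-down d)

  up-step : ∀ c x → Up (act c x) → rep (h (act c x)) < rep x
  up-step c x u = subst (rep (h (act c x)) <_) (rep-act c x) (h-up u)

  -- Steps up arrive at `Up` points. A letter that moves such a point leads to a `Down` point, so
  -- the next step goes up as well.
  climb : ∀ cs x → Up x → ¬ SomeFix cs x →
    Up (run cs $ₚ x) × rep x ≤ rep (run cs $ₚ x)
  climb []       x u _     = u , inj₂ refl
  climb (c ∷ cs) x u nofix =
    let d        = moved-up-down c u (nofix ∘ inj₁)
        u′ , ≤′  = climb cs _ (mate-of-down-up d) (nofix ∘ inj₂)
    in u′ , ≤-trans (inj₁ (down-step c x d)) ≤′

  -- Without fixed letters a walk never turns from up to down: it only descends, or it ends with a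
  -- step up.
  descend : ∀ cs x → ¬ SomeFix cs x →
    Up (run cs $ₚ x) ⊎ rep (run cs $ₚ x) ≤ rep x
  descend []       x _     = inj₂ (inj₂ refl)
  descend (c ∷ cs) x nofix with side (act c x)
  ... | inj₂ d = inj₁ (proj₁ (climb cs _ (mate-of-down-up d) (nofix ∘ inj₂)))
  ... | inj₁ u with descend cs _ (nofix ∘ inj₂)
  ...   | inj₁ u′ = inj₁ u′
  ...   | inj₂ ≤′ = inj₂ (≤-trans ≤′ (inj₁ (up-step c x u)))

  closed-walk : ∀ c cs x → run (c ∷ cs) $ₚ x ≡ x → SomeFix (c ∷ cs) x
  closed-walk c cs x closed = dne impossible
    where
    impossible : ¬ ¬ SomeFix (c ∷ cs) x
    impossible nofix with side (act c x)
    ... | inj₂ d =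
          let _ , ≤′ = climb cs _ (mate-of-down-up d) (nofix ∘ inj₂)
          in <⇒≱ (down-step c x d) (subst (λ y → _ ≤ rep y) closed ≤′)
    ... | inj₁ u with descend cs _ (nofix ∘ inj₂)
    -- The walk comes back to `x` by a step up and left it by a step down, so the forbidden turn
    -- occurs at the base point.
    ...   | inj₁ u′ = up∧down u (moved-up-down c (subst Up closed u′) (nofix ∘ inj₁))
    ...   | inj₂ ≤′ = <⇒≱ (up-step c x u) (subst (λ y → rep y ≤ _) closed ≤′)

  -- Fixed points of words.

  Small : Pred (Perm κ) a
  Small f = Trivial f ⊎ Bounded (Fix κ f)

  member-small : ∀ {g} → g ∈ Member → Small g
  member-small {g} g∈G with em {Trivial g}
  ... | yes triv = inj₁ triv
  ... | no ¬triv = inj₂ (⋡⇒bounded (proj₂ (cofinitary g g∈G ¬triv)))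

  small-resp : ∀ f g → (∀ x → f $ₚ x ≡ g $ₚ x) → Small f → Small g
  small-resp f g eq (inj₁ triv)    = inj₁ λ x → trans (sym (eq x)) (triv x)
  small-resp f g eq (inj₂ bounded) = inj₂ (bounded-⊆ (λ fix → trans (eq _) fix) bounded)

  -- The two products are conjugate: `u` carries fixed points of `v ∙ u` to fixed points of `u ∙ v`.
  small-swap : ∀ u v → Small (u ∙ v) → Small (v ∙ u)
  small-swap u v (inj₁ triv)    = inj₁ λ x → Injection.injective (↔⇒↣ u) (triv (u $ₚ x))
  small-swap u v (inj₂ bounded) = inj₂ (bounded-⊆ (cong (u $ₚ_)) (bounded-preimage u bounded))

  h-small : Small hₚ
  h-small = inj₂ (bounded-⊆ (λ fix → contradiction (cong rep fix) (h-leaves-orbit _)) bounded-∅)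

  -- A finite union of preimages of bounded sets, one for each letter.
  nontrivial-letters : ∀ {cs} → All (λ c → ¬ Trivial (proj₁ c)) cs → Bounded (SomeFix cs)
  nontrivial-letters []                    = bounded-∅
  nontrivial-letters {c ∷ _} (¬triv ∷ all) = bounded-∪
    ([ (λ triv → contradiction triv ¬triv) , id ]′ (member-small (proj₂ c)))
    (bounded-preimage (hₚ ∙ proj₁ c) (nontrivial-letters all))

  -- Conjugating by `run cs` makes `e` the last letter applied; there it drops out and leaves only
  -- its `h`.
  rotate : ∀ bs cs {e} → Trivial (proj₁ e) →
    Small (hₚ ∙ run (cs ++ bs)) → Small (run (bs ++ e ∷ cs))
  rotate bs cs {e} triv small =
    small-resp (run (e ∷ cs) ∙ run bs) (run (bs ++ e ∷ cs)) (λ x → sym (run-++ bs (e ∷ cs) x))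
      (small-swap (hₚ ∙ (proj₁ e ∙ run bs)) (run cs)
        (small-resp (hₚ ∙ run (cs ++ bs)) ((hₚ ∙ (proj₁ e ∙ run bs)) ∙ run cs)
          (λ x → cong h (trans (run-++ cs bs x) (sym (triv _)))) small))

  -- Conjugation merges the outer letter into `b`, giving `run es`. The induction is on length
  -- because rotating the word does not leave a sublist.
  word-small : ∀ cs → Acc ℕ._<_ (length cs) → ∀ c → Small (proj₁ c ∙ run cs)
  word-small []       _         c = member-small (proj₂ c)
  word-small (b ∷ cs) (acc rec) (g , g∈G) =
    small-swap (run (b ∷ cs)) g
      ([ (λ all → inj₂ (bounded-⊆ (closed-walk e cs _) (nontrivial-letters all)))
       , cancel
       ]′ (All.decide (λ _ → swap (toSum em)) es))
    where
    e : Letter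
    e = proj₁ b ∙ g , ∘-closed (proj₂ b) g∈G

    es : List Letter
    es = e ∷ cs

    shorter : ∀ ds → length es ≡ ℕ.suc (length ds) → Small (hₚ ∙ run ds)
    shorter ds eq with initLast ds
    ... | []        = h-small
    ... | ds′ ∷ʳ′ d =
          -- The leading `h` cancels the last `h` of `run ds`. Thus `ds′` is two letters shorter
          -- than `es`, one more than the induction needs.
          small-resp (proj₁ d ∙ run ds′) (hₚ ∙ run (ds′ ∷ʳ d))
            (λ x → sym (trans (cong h (run-++ ds′ [ d ] x)) (mate-involutive _)))
            (word-small ds′ (rec (ℕ.s≤s (ℕ.≤-trans (ℕ.n≤1+n _) (ℕ.≤-reflexive
              (trans (sym (trans (length-++ ds′) (ℕ.+-comm _ 1))) (sym (ℕ.suc-injective eq))))))) d)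

    cancel : Any (λ c → Trivial (proj₁ c)) es → Small (run es)
    cancel any with t , t∈es , triv ← find any with bs , ds , eq ← ∈-∃++ t∈es =
      subst (Small ∘ run) (sym eq) (rotate bs ds triv (shorter (ds ++ bs)
        (trans (cong length eq) (length-++-comm bs (t ∷ ds)))))

  -- The subgroup generated by `G` and the matching.

  Word : Pred (Perm κ) a
  Word f = ∃₂ λ cs c → ∀ x → act c (run cs $ₚ x) ≡ f $ₚ x

  idLetter : Letter
  idLetter = ↔-id Carrier , id-closed

  ∈⇒word : Member ⊆ Word
  ∈⇒word {g} g∈G = [] , (g , g∈G) , λ _ → refl

  -- Words begin and end with a letter, so identity letters pad `h` on both sides.
  h-word : Word hₚ
  h-word = [ idLetter ] , idLetter , λ _ → refl

  word-resp : ∀ f g → (∀ x → f $ₚ x ≡ g $ₚ x) → Word f → Word g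
  word-resp f g eq (cs , c , e) = cs , c , λ x → trans (e x) (eq x)

  word-∘ : ∀ f g → Word f → Word g → Word (f ∙ g)
  word-∘ f g ([] , c , e) (bs , b , e′) =
    bs , (proj₁ c ∙ proj₁ b , ∘-closed (proj₂ c) (proj₂ b)) ,
    λ x → trans (cong (act c) (e′ x)) (e (g $ₚ x))
  word-∘ f g (d ∷ cs , c , e) (bs , b , e′) =
    -- The outer letter of `g` meets the first letter of `f` with no `h` between them, so the two
    -- merge.
    bs ++ (proj₁ d ∙ proj₁ b , ∘-closed (proj₂ d) (proj₂ b)) ∷ cs , c ,
    λ x → trans (cong (act c) (run-++ bs _ x))
            (trans (cong (λ y → act c (run cs $ₚ h (act d y))) (e′ x)) (e (g $ₚ x)))

  run-⁻¹-word : ∀ cs → Word (↔-sym (run cs))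
  run-⁻¹-word []       = ∈⇒word {↔-id Carrier} id-closed
  run-⁻¹-word (c ∷ cs) =
    -- `hₚ` can stand for its own inverse, since both of its directions are the same function.
    word-∘ (c⁻¹ ∙ hₚ) (↔-sym (run cs))
      (word-∘ c⁻¹ hₚ (∈⇒word {c⁻¹} (⁻¹-closed (proj₂ c))) h-word) (run-⁻¹-word cs)
    where
    c⁻¹ : Perm κ
    c⁻¹ = ↔-sym (proj₁ c)

  word-⁻¹ : ∀ f → Word f → Word (↔-sym f)
  word-⁻¹ f (cs , c , e) =
    word-resp (↔-sym (run cs) ∙ ↔-sym (proj₁ c)) (↔-sym f) inverse
      (word-∘ (↔-sym (run cs)) (↔-sym (proj₁ c))
        (run-⁻¹-word cs) (∈⇒word {↔-sym (proj₁ c)} (⁻¹-closed (proj₂ c))))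
    where
    w : Perm κ
    w = proj₁ c ∙ run cs

    inverse : ∀ x → Inverse.from w x ≡ Inverse.from f x
    inverse x = Inverse.inverseʳ w
      (trans (sym (Inverse.strictlyInverseˡ f x)) (sym (e (Inverse.from f x))))

  extension : Subgroup κ
  extension = record
    { Member    = Word
    ; ≗ₚ-closed = λ {f} {g} → word-resp f g
    ; id-closed = ∈⇒word {↔-id Carrier} id-closed
    ; ∘-closed  = λ {f} {g} → word-∘ f g
    ; ⁻¹-closed = λ {f} → word-⁻¹ f
    }

  extension-cofinitary : IsCofinitaryGroup κ extension
  extension-cofinitary f (cs , c , e) ¬triv =
    [ (λ triv → contradiction triv ¬triv) , bounded⇒≺ ]′
      (small-resp (proj₁ c ∙ run cs) f e (word-small cs (<-wellFounded _) c))

  extension-proper : Member ⊂ Word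
  extension-proper = (λ {g} → ∈⇒word {g}) , λ Word⊆Member →
    let x , _ = ∃-< in h-leaves-orbit x (rep-act (hₚ , Word⊆Member {hₚ} h-word) x)

theorem2p1 : (a : Level) → ExcludedMiddle a →
    (κ : Cardinal a) → Uncountable κ → Regular κ → κ^<κ≡κ κ →
    (G : Subgroup κ) → IsMaximalCofinitaryGroup κ G →
    Orbits κ G ≺ setoid (Cardinal.Carrier κ)
theorem2p1 a em κ uncountable regular _ G (cofinitary , maximal) =
  OrbitRepresentatives.Orbits≼κ em κ G , λ κ≼Orbits →
    let open Extension em κ uncountable regular G cofinitary κ≼Orbits
    in maximal extension extension-proper extension-cofinitary
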